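{- Let $A$ be a finite alphabet and let $F:A^{\mathbb N}\to A^{\mathbb N}$ be a dill map with diameter $\theta$ and local rule $f$. Then $F$ induces a well-defined map on the quotient space $X_{W_L}$ (i.e. for all $x,y\in A^{\mathbb N}$, $W_L(x,y)=0$ implies $W_L(F(x),F(y))=0$) if and only if $F$ is $W_L$-constant or diamond-uniform.
   Context: For a word $u$ (or $x\in A^{\mathbb N}$) write $u_{[a,b)}=u_a\cdots u_{b-1}$. The Levenshtein distance of finite words $u,v$ is $d_L(u,v)=\frac12\min\{m+m'\}$ over all ways of deleting $m$ letters from $u$ and $m'$ letters from $v$ so that the resulting words coincide. The pseudo-metric $W_L$ on $A^{\mathbb N}$ is $W_L(x,y)=\limsup_{\ell\to\infty}\max_{k\in\mathbb N}\frac{d_L(x_{[k,k+\ell)},y_{[k,k+\ell)})}{\ell}$, and $X_{W_L}$ is the quotient of $A^{\mathbb N}$ by $x\sim y\iff W_L(x,y)=0$. A dill map with diameter $\theta\in\mathbb N\setminus\{0\}$ and local rule $f:A^\theta\to A^+$ (nonempty words) is $F(x)=f(x_{[0,\theta)})f(x_{[1,\theta+1)})f(x_{[2,\theta+2)})\cdots$. Extend $f$ to $f^*:A^*\to A^*$ by $f^*(u)=f(u_{[0,\theta)})f(u_{[1,\theta+1)})\cdots f(u_{[|u|-\theta,|u|)})$ if $|u|\ge\theta$ and $f^*(u)$ the empty word otherwise. $F$ is $W_L$-constant if $W_L(F(x),F(y))=0$ for all $x,y$. $F$ is diamond-uniform if for every $\ell$ and all $u,v\in A^\ell$ with $u_{[0,\theta)}=v_{[0,\theta)}$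 and $u_{[\ell-\theta,\ell)}=v_{[\ell-\theta,\ell)}$, one has $|f^*(u)|=|f^*(v)|$. -}

module Defs where

open import Data.Nat using (ℕ; zero; suc; _+_; _*_; _∸_; _≤_)
open import Data.Fin using (Fin; toℕ)
open import Data.List using (List; []; _∷_; length; applyUpTo; take; drop; _++_)
open import Data.List.NonEmpty using (List⁺; _∷_) renaming (toList to toList⁺)
open import Data.List.Relation.Binary.Sublist.Propositional using (_⊆_)
open import Data.Vec using (Vec; tabulate)
open import Data.Maybe using (Maybe; just; nothing; map)
open import Data.Product using (Σ; ∃; _×_; _,_)
open import Data.Sum using (_⊎_)
open import Relation.Binary.PropositionalEquality using (_≡_)

Seq : Set → Set
Seq A = ℕ → A

seg : {A : Set} → Seq A → ℕ → ℕ → List A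
seg x k ℓ = applyUpTo (λ j → x (k + j)) ℓ

-- W_L(x,y) = 0, unfolded without reals:
-- for every ε = 1/(n+1) there is L such that for all ℓ ≥ L and all k,
-- d_L(x_[k,k+ℓ), y_[k,k+ℓ)) ≤ ℓ/(n+1).  Here d_L(u,v) ≤ c is witnessed by a
-- common word w obtained by deleting letters from u and v (w ⊆ u, w ⊆ v as
-- sublists), with (|u| - |w|) + (|v| - |w|) deletions, i.e. d_L = that/2.
WL0 : {A : Set} → Seq A → Seq A → Set
WL0 {A} x y =
  ∀ (n : ℕ) → ∃ λ (L : ℕ) → ∀ (ℓ : ℕ) → L ≤ ℓ → ∀ (k : ℕ) →
    ∃ λ (w : List A) → (w ⊆ seg x k ℓ) × (w ⊆ seg y k ℓ) ×
      (((length (seg x k ℓ) ∸ length w) + (length (seg y k ℓ) ∸ length w)) * suc n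
        ≤ 2 * ℓ)

mutual
  concatAt : {A : Set} → (ℕ → List⁺ A) → ℕ → A
  concatAt g zero with g 0
  ... | h ∷ t = h
  concatAt g (suc m) with g 0
  ... | h ∷ t = concatAt' t g m

  concatAt' : {A : Set} → List A → (ℕ → List⁺ A) → ℕ → A
  concatAt' [] g m = concatAt (λ i → g (suc i)) m
  concatAt' (c ∷ cs) g zero = c
  concatAt' (c ∷ cs) g (suc m) = concatAt' cs g m

window : {A : Set} (θ : ℕ) → Seq A → ℕ → Vec A θ
window θ x i = tabulate (λ j → x (i + toℕ j))

dill : {A : Set} (θ : ℕ) → (Vec A θ → List⁺ A) → Seq A → Seq A
dill θ f x = concatAt (λ i → f (window θ x i))

takeVec : {A : Set} (θ : ℕ) → List A → Maybe (Vec A θ)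
takeVec zero u = just Vec.[]
  where import Data.Vec as Vec
takeVec (suc θ) [] = nothing
takeVec (suc θ) (c ∷ cs) = map (c Data.Vec.∷_) (takeVec θ cs)

fstar : {A : Set} (θ : ℕ) → (Vec A θ → List⁺ A) → List A → List A
fstar θ f [] = []
fstar θ f (c ∷ cs) with takeVec θ (c ∷ cs)
... | just v = toList⁺ (f v) ++ fstar θ f cs
... | nothing = []

WLConstant : {A : Set} → (Seq A → Seq A) → Set
WLConstant F = ∀ x y → WL0 (F x) (F y)

DiamondUniform : {A : Set} (θ : ℕ) → (Vec A θ → List⁺ A) → Set
DiamondUniform {A} θ f =
  ∀ (ℓ : ℕ) (u v : List A) → length u ≡ ℓ → length v ≡ ℓ →
    take θ u ≡ take θ v → drop (ℓ ∸ θ) u ≡ drop (ℓ ∸ θ) v →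
    length (fstar θ f u) ≡ length (fstar θ f v)

WLCompatible : {A : Set} → (Seq A → Seq A) → Set
WLCompatible F = ∀ x y → WL0 x y → WL0 (F x) (F y)

{-# OPTIONS --safe #-}
-- For a word u and a continuation z, let W z u be the total length of the images
-- of the windows of u ⌢ z that start in u, and let o be a fixed letter. Whether F
-- is diamond-uniform is decided by finitely many diamonds, s b o^θ against
-- s o o^θ with |s| = θ.
--
-- If these are balanced, telescoping shows that the image of x_[0,i) has length
-- i κ + O(1), where κ = |f(o^θ)|. Equal positions of F x and F y then come from
-- equal positions of x and y up to O(1), and a deletion in x costs O(1) deletions
-- in F x.
--
-- If one is unbalanced, substituting a letter c for b in s b stretches the image
-- by some δ > 0. Given x and y, build x′ and y′ differing only in such letters,
-- ever more sparsely, so that x′ and y′ are W_L-equivalent. In phase r, enough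
-- substitutions shift F y′ against F x′ so that the image of y_[0,r+θ) in F y′
-- faces the image of x_[0,r+θ) in F x′; then the reverse substitutions undo the
-- shift. Compatibility for x′ and y′ thus forces F x and F y to be W_L-equivalent.
module Submission where

open import Defs
open import Data.Nat
open import Data.Nat.Properties
open import Data.Nat.DivMod using (_/_; _%_; m≡m%n+[m/n]*n; m%n<n; m/n≤m; /-monoˡ-≤; m*n/n≡m)
open import Data.Nat.Tactic.RingSolver using (solve-∀)
open import Data.Fin using (Fin; zero; suc; toℕ)
open import Data.Fin.Properties using (toℕ<n)
open import Data.Vec using (Vec; []; _∷_)
open import Data.Vec.Properties using (tabulate-cong)
open import Data.Maybe as Maybe using (just)
open import Data.List using (List; []; _∷_; _++_; length; replicate; [_]; take; drop)
open import Data.List.NonEmpty using (List⁺; _∷_) renaming (toList to toList⁺)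
open import Data.List.Properties
  using (length-++; length-applyUpTo; length-replicate; ++-assoc; ++-identityʳ; length-drop)
open import Data.List.Relation.Binary.Sublist.Propositional using (_⊆_; []; _∷_; _∷ʳ_)
open import Data.List.Relation.Binary.Sublist.Propositional.Properties using (length-mono-≤)
open import Data.Product using (∃; _×_; _,_; proj₁; proj₂)
open import Data.Sum using (_⊎_; inj₁; inj₂)
open import Function.Bundles using (_⇔_; mk⇔)
open import Relation.Binary using (tri<; tri≈; tri>)
open import Relation.Binary.PropositionalEquality hiding ([_]; J)
open import Relation.Nullary using (contradiction)
open import Relation.Nullary.Decidable using (toSum)

private variable
  A : Set
  c d e k ℓ m n R : ℕ
  u v w : List A
  x y : Seq A

-- Edit scripts between words

-- The index only bounds the number of deletions, so Lev is monotone in it.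
data Lev {A : Set} : ℕ → List A → List A → Set where
  done : Lev d [] []
  keep : ∀ {a} → Lev d u v → Lev d (a ∷ u) (a ∷ v)
  delˡ : ∀ {a} → Lev d u v → Lev (suc d) (a ∷ u) v
  delʳ : ∀ {a} → Lev d u v → Lev (suc d) u (a ∷ v)

Lev-mono : d ≤ e → Lev d u v → Lev e u v
Lev-mono _ done = done
Lev-mono d≤e (keep p) = keep (Lev-mono d≤e p)
Lev-mono (s≤s d≤e) (delˡ p) = delˡ (Lev-mono d≤e p)
Lev-mono (s≤s d≤e) (delʳ p) = delʳ (Lev-mono d≤e p)

Lev-refl : ∀ (u : List A) → Lev 0 u u
Lev-refl [] = done
Lev-refl (a ∷ u) = keep (Lev-refl u)

Lev-sym : Lev d u v → Lev d v u
Lev-sym done = done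
Lev-sym (keep p) = keep (Lev-sym p)
Lev-sym (delˡ p) = delʳ (Lev-sym p)
Lev-sym (delʳ p) = delˡ (Lev-sym p)

-- Two scripts compose by running along the middle word in parallel, letters absent from it being
-- handled first.
Lev-trans : Lev d u v → Lev e v w → Lev (d + e) u w
Lev-trans {d = d} done q = Lev-mono (m≤n+m _ d) q
Lev-trans (delˡ p) q = delˡ (Lev-trans p q)
Lev-trans {d = d} {e = suc e} p@(keep _) (delʳ q) =
  Lev-mono (≤-reflexive (sym (+-suc d e))) (delʳ (Lev-trans p q))
Lev-trans {d = d} {e = suc e} p@(delʳ _) (delʳ q) =
  Lev-mono (≤-reflexive (sym (+-suc d e))) (delʳ (Lev-trans p q))
Lev-trans (keep p) (keep q) = keep (Lev-trans p q)
Lev-trans {d = d} {e = suc e} (keep p) (delˡ q) =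
  Lev-mono (≤-reflexive (sym (+-suc d e))) (delˡ (Lev-trans p q))
Lev-trans (delʳ p) (keep q) = delʳ (Lev-trans p q)
-- A letter that the first script inserts and the second removes disappears, leaving two deletions
-- of the budget over.
Lev-trans {e = suc e} (delʳ {d = d} p) (delˡ q) =
  Lev-mono (≤-trans (+-monoʳ-≤ d (n≤1+n e)) (n≤1+n _)) (Lev-trans p q)

Lev-++ : ∀ {u' v' : List A} → Lev d u v → Lev e u' v' → Lev (d + e) (u ++ u') (v ++ v')
Lev-++ {d = d} done q = Lev-mono (m≤n+m _ d) q
Lev-++ (keep p) q = keep (Lev-++ p q)
Lev-++ (delˡ p) q = delˡ (Lev-++ p q)
Lev-++ (delʳ p) q = delʳ (Lev-++ p q)

Lev-[]ʳ : ∀ (u : List A) → Lev (length u) u []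
Lev-[]ʳ [] = done
Lev-[]ʳ (a ∷ u) = delˡ (Lev-[]ʳ u)

Lev-total : ∀ (u v : List A) → Lev (length u + length v) u v
Lev-total u v = Lev-trans (Lev-[]ʳ u) (Lev-sym (Lev-[]ʳ v))

Lev-dropˡ : ∀ (u v : List A) → Lev (length u) (u ++ v) v
Lev-dropˡ u v = Lev-mono (≤-reflexive (+-identityʳ _)) (Lev-++ (Lev-[]ʳ u) (Lev-refl v))

Lev-dropʳ : ∀ (u v : List A) → Lev (length v) (u ++ v) u
Lev-dropʳ [] v = Lev-[]ʳ v
Lev-dropʳ (a ∷ u) v = keep (Lev-dropʳ u v)

Lev⇒⊆ : Lev d u v → ∃ λ w → (w ⊆ u) × (w ⊆ v) ×
  ((length u ∸ length w) + (length v ∸ length w) ≤ d)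
Lev⇒⊆ done = [] , [] , [] , z≤n
Lev⇒⊆ (keep p) with Lev⇒⊆ p
... | w , w⊆u , w⊆v , le = _ ∷ w , refl ∷ w⊆u , refl ∷ w⊆v , le
Lev⇒⊆ (delˡ {v = v} p) with Lev⇒⊆ p
... | w , w⊆u , w⊆v , le = w , _ ∷ʳ w⊆u , w⊆v ,
  ≤-trans (≤-reflexive (cong (_+ (length v ∸ length w)) (+-∸-assoc 1 (length-mono-≤ w⊆u)))) (s≤s le)
Lev⇒⊆ (delʳ {u = u} p) with Lev⇒⊆ p
... | w , w⊆u , w⊆v , le = w , w⊆u , _ ∷ʳ w⊆v ,
  ≤-trans (≤-reflexive (trans (cong ((length u ∸ length w) +_) (+-∸-assoc 1 (length-mono-≤ w⊆v)))
    (+-suc _ _))) (s≤s le)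

⊆⇒Lev : w ⊆ u → Lev (length u ∸ length w) u w
⊆⇒Lev [] = done
⊆⇒Lev (a ∷ʳ p) = Lev-mono (≤-reflexive (sym (+-∸-assoc 1 (length-mono-≤ p)))) (delˡ (⊆⇒Lev p))
⊆⇒Lev (refl ∷ p) = keep (⊆⇒Lev p)

-- W_L-equivalence in terms of edit scripts

LevWL0 : Seq A → Seq A → Set
LevWL0 x y = ∀ q → ∃ λ L → ∀ ℓ → L ≤ ℓ → ∀ k →
  ∃ λ d → Lev d (seg x k ℓ) (seg y k ℓ) × d * q ≤ ℓ

WL0⇒LevWL0 : ∀ (x y : Seq A) → WL0 x y → LevWL0 x y
-- `WL0` compares deletions with `2 * ℓ`; the precision `2 * q` makes the factor 2 cancel.
WL0⇒LevWL0 x y h q with h (2 * q)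
... | L , h' = L , λ ℓ L≤ℓ k → let (w , p , p' , le) = h' ℓ L≤ℓ k in
  (length (seg x k ℓ) ∸ length w) + (length (seg y k ℓ) ∸ length w) ,
  Lev-trans (⊆⇒Lev p) (Lev-sym (⊆⇒Lev p')) ,
  halve ((length (seg x k ℓ) ∸ length w) + (length (seg y k ℓ) ∸ length w)) le
  where
  comm : ∀ a d q → a * (d * q) ≡ d * (a * q)
  comm = solve-∀
  halve : ∀ d {ℓ} → d * suc (2 * q) ≤ 2 * ℓ → d * q ≤ ℓ
  halve d le = *-cancelˡ-≤ 2
    (≤-trans (≤-reflexive (comm 2 d q)) (≤-trans (*-monoʳ-≤ d (n≤1+n (2 * q))) le))

LevWL0⇒WL0 : ∀ (x y : Seq A) → LevWL0 x y → WL0 x y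
LevWL0⇒WL0 x y h n with h (suc n)
... | L , h' = L , λ ℓ L≤ℓ k → let (d , p , le) = h' ℓ L≤ℓ k ; (w , p' , q' , le') = Lev⇒⊆ p in
  w , p' , q' , ≤-trans (*-monoˡ-≤ (suc n) le') (≤-trans le (m≤n*m ℓ 2))

-- A factor `c` and a constant `K`, which may depend on `q`, vanish in the limit: precision
-- `c * q * 2` lets the multiple of `d` use one half of the allowance, and a length of at least
-- `K + K * q * 2` lets the constants use the other.
LevWL0-affine : ∀ (x y : Seq A) c →
  (∀ q → ∃ λ K → ∀ ℓ → K ≤ ℓ → ∀ k →
    ∃ λ d → Lev (d * c + K) (seg x k ℓ) (seg y k ℓ) × d * q ≤ ℓ + K) →
  LevWL0 x y
LevWL0-affine x y c h q with h (c * q * 2)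
... | K , h' = K + K * q * 2 , λ ℓ L≤ℓ k →
  let (d , p , le) = h' ℓ (≤-trans (m≤m+n K _) L≤ℓ) k in
  d * c + K , p , *-cancelˡ-≤ 2 (begin
    2 * ((d * c + K) * q)           ≡⟨ expand d c K q ⟩
    d * (c * q * 2) + K * q * 2     ≤⟨ +-monoˡ-≤ (K * q * 2) le ⟩
    ℓ + K + K * q * 2               ≡⟨ +-assoc ℓ K _ ⟩
    ℓ + (K + K * q * 2)             ≤⟨ +-monoʳ-≤ ℓ L≤ℓ ⟩
    ℓ + ℓ                           ≡⟨ cong (ℓ +_) (sym (+-identityʳ ℓ)) ⟩
    2 * ℓ                           ∎)
  where
  open ≤-Reasoning
  expand : ∀ d c K q → 2 * ((d * c + K) * q) ≡ d * (c * q * 2) + K * q * 2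
  expand = solve-∀

-- Shifts, prefixes and segments of sequences

σ : ℕ → Seq A → Seq A
σ k x j = x (k + j)

infix 4 _≈[_]_
_≈[_]_ : Seq A → ℕ → Seq A → Set
x ≈[ n ] y = ∀ j → j < n → x j ≡ y j

≈-sym : ∀ {x y : Seq A} → x ≈[ n ] y → y ≈[ n ] x
≈-sym p j j<n = sym (p j j<n)

≈-trans : ∀ {x y z : Seq A} → x ≈[ n ] y → y ≈[ n ] z → x ≈[ n ] z
≈-trans p q j j<n = trans (p j j<n) (q j j<n)

≈-mono : ∀ {x y : Seq A} → m ≤ n → x ≈[ n ] y → x ≈[ m ] y
≈-mono m≤n p j j<m = p j (<-≤-trans j<m m≤n)

≗⇒≈ : ∀ {x y : Seq A} → x ≗ y → x ≈[ n ] y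
≗⇒≈ p j _ = p j

≈-tail : ∀ {x y : Seq A} → x ≈[ suc n ] y → σ 1 x ≈[ n ] σ 1 y
≈-tail p j j<n = p (suc j) (s≤s j<n)

seg-cong : ∀ {x y : Seq A} ℓ → x ≈[ ℓ ] y → seg x 0 ℓ ≡ seg y 0 ℓ
seg-cong zero p = refl
seg-cong (suc ℓ) p = cong₂ _∷_ (p 0 z<s) (seg-cong ℓ (≈-tail p))

seg-++ : ∀ (x : Seq A) m n → seg x 0 (m + n) ≡ seg x 0 m ++ seg x m n
seg-++ x zero n = refl
seg-++ x (suc m) n = cong (x 0 ∷_) (seg-++ (σ 1 x) m n)

length-seg : ∀ (x : Seq A) k ℓ → length (seg x k ℓ) ≡ ℓ
length-seg x k ℓ = length-applyUpTo (σ k x) ℓ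

infixr 5 _⌢_
_⌢_ : List A → Seq A → Seq A
([] ⌢ z) = z
((c ∷ u) ⌢ z) zero = c
((c ∷ u) ⌢ z) (suc i) = (u ⌢ z) i

⌢-drop : ∀ (u : List A) {z : Seq A} → σ (length u) (u ⌢ z) ≗ z
⌢-drop [] j = refl
⌢-drop (c ∷ u) j = ⌢-drop u j

⌢-cong : ∀ (u : List A) {z z' : Seq A} → z ≈[ n ] z' → (u ⌢ z) ≈[ length u + n ] (u ⌢ z')
⌢-cong [] p = p
⌢-cong (c ∷ u) p zero _ = refl
⌢-cong (c ∷ u) p (suc j) (s≤s j<) = ⌢-cong u p j j<

⌢-++ : ∀ (u v : List A) {z : Seq A} → ((u ++ v) ⌢ z) ≗ (u ⌢ v ⌢ z)
⌢-++ [] v j = refl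
⌢-++ (c ∷ u) v zero = refl
⌢-++ (c ∷ u) v (suc j) = ⌢-++ u v j

⌢-take : ∀ (u : List A) {z z' : Seq A} → (u ⌢ z) ≈[ length u ] (u ⌢ z')
⌢-take u = ≈-mono (m≤m+n _ 0) (⌢-cong u (λ _ ()))

seg-⌢ : ∀ (x : Seq A) m → (seg x 0 m ⌢ σ m x) ≗ x
seg-⌢ x zero j = refl
seg-⌢ x (suc m) zero = refl
seg-⌢ x (suc m) (suc j) = seg-⌢ (σ 1 x) m j

seg-of-⌢ : ∀ (u : List A) {z : Seq A} n → seg (u ⌢ z) 0 (length u + n) ≡ u ++ seg z 0 n
seg-of-⌢ [] n = refl
seg-of-⌢ (c ∷ u) n = cong (c ∷_) (seg-of-⌢ u n)

Near : ℕ → ℕ → ℕ → Set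
Near c m n = m ≤ n + c × n ≤ m + c

Near-trans : ∀ {p} → Near c m n → Near d n p → Near (c + d) m p
Near-trans {c = c} {m = m} {d = d} {p = p} (a , b) (a' , b') =
  ≤-trans a (≤-trans (+-monoˡ-≤ c a') (≤-reflexive (trans (+-assoc p d c) (cong (p +_) (+-comm d c))))) ,
  ≤-trans b' (≤-trans (+-monoˡ-≤ d b) (≤-reflexive (+-assoc m c d)))

seg-Lev-length : ∀ (x : Seq A) k → Near c ℓ m → Lev c (seg x k ℓ) (seg x k m)
seg-Lev-length {c = c} x k (p , q) = go x k p q where
  grow : ∀ (x : Seq _) k {ℓ m} → ℓ ≤ m → m ≤ ℓ + c → Lev c (seg x k m) (seg x k ℓ)
  grow x k {ℓ} ℓ≤m q with m≤n⇒∃[o]m+o≡n ℓ≤m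
  ... | o , refl = Lev-mono (subst (_≤ c) (sym (length-seg (σ k x) ℓ o)) (+-cancelˡ-≤ ℓ _ _ q))
    (subst (λ w → Lev (length (seg (σ k x) ℓ o)) w (seg x k ℓ)) (sym (seg-++ (σ k x) ℓ o)) (Lev-dropʳ (seg x k ℓ) _))
  go : ∀ (x : Seq _) k {ℓ m} → ℓ ≤ m + c → m ≤ ℓ + c → Lev c (seg x k ℓ) (seg x k m)
  go x k {ℓ} {m} p q with ≤-total ℓ m
  ... | inj₁ ℓ≤m = Lev-sym (grow x k ℓ≤m q)
  ... | inj₂ m≤ℓ = grow x k m≤ℓ p

-- Both segments arise from the one of length `ℓ + e` at `k`, by deleting `e` letters at its end or
-- at its beginning.
seg-Lev-offset : ∀ (x : Seq A) ℓ e k → Lev (e + e) (seg x k ℓ) (seg x (k + e) ℓ)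
seg-Lev-offset x ℓ e k = Lev-trans
  (Lev-sym (subst₂ (λ n w → Lev n w (seg x k ℓ)) (length-seg (σ k x) ℓ e) (sym (seg-++ (σ k x) ℓ e))
    (Lev-dropʳ (seg x k ℓ) _)))
  (subst (λ n → Lev e (seg x k n) (seg x (k + e) ℓ)) (+-comm e ℓ)
    (subst₂ (λ n w → Lev n w (seg x (k + e) ℓ)) (length-seg x k e) (sym split) (Lev-dropˡ (seg x k e) _)))
  where
  split : seg x k (e + ℓ) ≡ seg x k e ++ seg x (k + e) ℓ
  split = trans (seg-++ (σ k x) e ℓ)
    (cong (seg x k e ++_) (seg-cong ℓ (λ j _ → cong x (sym (+-assoc k e j)))))

seg-Lev-start : ∀ (x : Seq A) ℓ → Near c k m → Lev (c + c) (seg x k ℓ) (seg x m ℓ)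
seg-Lev-start {c = c} {k = k} {m = m} x ℓ (p , q) with ≤-total k m
... | inj₁ k≤m with m≤n⇒∃[o]m+o≡n k≤m
...   | o , refl = let o≤c = +-cancelˡ-≤ k _ _ q in
        Lev-mono (+-mono-≤ o≤c o≤c) (seg-Lev-offset x ℓ o k)
seg-Lev-start {c = c} {k = k} {m = m} x ℓ (p , q) | inj₂ m≤k with m≤n⇒∃[o]m+o≡n m≤k
...   | o , refl = let o≤c = +-cancelˡ-≤ m _ _ p in
        Lev-mono (+-mono-≤ o≤c o≤c) (Lev-sym (seg-Lev-offset x ℓ o m))

-- The bound for `u` and `v` is uniform in the position, so the prefixes of `x` and `y` may be found
-- arbitrarily far out. Their misalignment is fixed by `i` and `j`, so realigning costs a constant
-- number of deletions.
LevWL0-transfer : ∀ (u v x y : Seq A) i j → LevWL0 u v →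
  (∀ r → ∃ λ P → ∃ λ P' → P + i ≡ P' + j × (σ P u ≈[ r ] x) × (σ P' v ≈[ r ] y)) → LevWL0 x y
LevWL0-transfer u v x y i j h appears = LevWL0-affine x y 1 close
  where
  K₀ : ℕ
  K₀ = (i + i) + (j + j)
  seg-found : ∀ u x {P r} i {ℓ} → i + ℓ ≤ r → σ P u ≈[ r ] x → seg u (P + i) ℓ ≡ seg x i ℓ
  seg-found u x {P} i {ℓ} i+ℓ≤r p = seg-cong ℓ (λ j j<ℓ →
    trans (cong u (+-assoc P i j)) (p (i + j) (<-≤-trans (+-monoʳ-< i j<ℓ) i+ℓ≤r)))
  swap : ∀ p k j → p + (k + j) ≡ k + (p + j)
  swap = solve-∀
  total : ∀ a b d → a + (d + b) ≡ d * 1 + (a + b)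
  total = solve-∀
  close : ∀ q → ∃ λ K → ∀ ℓ → K ≤ ℓ → ∀ k →
    ∃ λ d → Lev (d * 1 + K) (seg x k ℓ) (seg y k ℓ) × d * q ≤ ℓ + K
  close q with h q
  ... | L , h' = L + K₀ , far
    where
    far : ∀ ℓ → L + K₀ ≤ ℓ → ∀ k →
      ∃ λ d → Lev (d * 1 + (L + K₀)) (seg x k ℓ) (seg y k ℓ) × d * q ≤ ℓ + (L + K₀)
    -- This prefix contains the segments of length `ℓ` at both `k + i` and `k + j`.
    far ℓ K≤ℓ k with appears (k + i + j + ℓ)
    ... | P , P' , eq , p , p' with h' ℓ (≤-trans (m≤m+n L K₀) K≤ℓ) (P + (k + i))
    ...   | d , lev , le = d ,
      Lev-mono (≤-trans (≤-reflexive (total (i + i) (j + j) d)) (+-monoʳ-≤ (d * 1) (m≤n+m K₀ L)))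
        (Lev-trans (seg-Lev-offset x ℓ i k) (Lev-trans
          (subst₂ (Lev d)
            (seg-found u x (k + i) (+-monoˡ-≤ ℓ (m≤m+n (k + i) j)) p)
            (trans (cong (λ n → seg v n ℓ) index)
              (seg-found v y (k + j) (+-monoˡ-≤ ℓ (+-monoˡ-≤ j (m≤m+n k i))) p'))
            lev)
          (Lev-sym (seg-Lev-offset y ℓ j k)))) ,
      ≤-trans le (m≤m+n ℓ _)
      where
      index : P + (k + i) ≡ P' + (k + j)
      index = trans (swap P k i) (trans (cong (k +_) eq) (sym (swap P' k j)))

-- Dill maps and the positions of their blocks

concatAt-⌢ : ∀ (g : ℕ → List⁺ A) → concatAt g ≗ (toList⁺ (g 0) ⌢ concatAt (λ i → g (suc i)))
concatAt-⌢ g zero with g 0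
... | h ∷ t = refl
concatAt-⌢ g (suc m) with g 0
... | h ∷ t = tail t m
  where
  tail : ∀ t m → concatAt' t g m ≡ (t ⌢ concatAt (λ i → g (suc i))) m
  tail [] m = refl
  tail (c ∷ t) zero = refl
  tail (c ∷ t) (suc m) = tail t m

1≤length⁺ : ∀ (u : List⁺ A) → 1 ≤ length (toList⁺ u)
1≤length⁺ (_ ∷ _) = z<s

seg-concatAt : ∀ (g : ℕ → List⁺ A) n →
  seg (concatAt g) 0 (length (toList⁺ (g 0)) + n) ≡ toList⁺ (g 0) ++ seg (concatAt (λ i → g (suc i))) 0 n
seg-concatAt g n = trans (seg-cong _ (≗⇒≈ (concatAt-⌢ g))) (seg-of-⌢ (toList⁺ (g 0)) n)

window-cong : ∀ {x y : Seq A} → x ≈[ n ] y → window n x 0 ≡ window n y 0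
window-cong p = tabulate-cong (λ j → p (toℕ j) (toℕ<n j))

module DillMap {A : Set} (θ : ℕ) (f : Vec A θ → List⁺ A) where

  F : Seq A → Seq A
  F = dill θ f

  block : Seq A → List A
  block x = toList⁺ (f (window θ x 0))

  image : Seq A → List A → List A
  image z [] = []
  image z (c ∷ u) = block ((c ∷ u) ⌢ z) ++ image z u

  -- N x i is the position at which the image of the i-th window starts in F x.
  N : Seq A → ℕ → ℕ
  N x zero = 0
  N x (suc i) = length (block x) + N (σ 1 x) i

  W : Seq A → List A → ℕ
  W z u = N (u ⌢ z) (length u)

  block-cong : ∀ {x y} → x ≈[ θ ] y → block x ≡ block y
  block-cong p = cong (λ v → toList⁺ (f v)) (window-cong p)

  F-⌢ : ∀ x → F x ≗ (block x ⌢ F (σ 1 x))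
  F-⌢ x = concatAt-⌢ (λ i → f (window θ x i))

  F-shift : ∀ x i j → F x (N x i + j) ≡ F (σ i x) j
  F-shift x zero j = refl
  F-shift x (suc i) j = begin
    F x (length (block x) + N (σ 1 x) i + j)
      ≡⟨ cong (F x) (+-assoc (length (block x)) _ j) ⟩
    F x (length (block x) + (N (σ 1 x) i + j))
      ≡⟨ F-⌢ x (length (block x) + (N (σ 1 x) i + j)) ⟩
    (block x ⌢ F (σ 1 x)) (length (block x) + (N (σ 1 x) i + j))
      ≡⟨ ⌢-drop (block x) _ ⟩
    F (σ 1 x) (N (σ 1 x) i + j)
      ≡⟨ F-shift (σ 1 x) i j ⟩
    F (σ (suc i) x) j ∎
    where open ≡-Reasoning

  -- Blocks are nonempty, so `n` windows already produce `n` letters of the image.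
  F-local : ∀ n {x y} → x ≈[ n + θ ] y → F x ≈[ n ] F y
  F-local (suc n) {x} {y} p = ≈-trans (≗⇒≈ (F-⌢ x))
    (≈-trans (subst (λ u → (block x ⌢ F (σ 1 x)) ≈[ suc n ] (u ⌢ F (σ 1 y)))
      (block-cong (≈-mono (m≤n+m θ (suc n)) p))
      (≈-mono (+-monoˡ-≤ n (1≤length⁺ (f (window θ x 0)))) (⌢-cong (block x) (F-local n (≈-tail p)))))
    (≈-sym (≗⇒≈ (F-⌢ y))))

  F-cong : ∀ {x y} → x ≗ y → F x ≗ F y
  F-cong p j = F-local (suc j) (≗⇒≈ p) j ≤-refl

  N-local : ∀ i {x y} → x ≈[ i + θ ] y → N x i ≡ N y i
  N-local zero p = refl
  N-local (suc i) p = cong₂ _+_ (cong length (block-cong (≈-mono (m≤n+m θ (suc i)) p)))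
    (N-local i (≈-tail p))

  W-local : ∀ u {z z'} → z ≈[ θ ] z' → W z u ≡ W z' u
  W-local u p = N-local (length u) (⌢-cong u p)

  W-++ : ∀ z u v → W z (u ++ v) ≡ W (v ⌢ z) u + W z v
  W-++ z [] v = refl
  W-++ z (c ∷ u) v = trans
    (cong₂ _+_ (cong length (block-cong (≗⇒≈ (⌢-++ (c ∷ u) v)))) (W-++ z u v))
    (sym (+-assoc (length (block ((c ∷ u) ⌢ v ⌢ z))) _ _))

  F-⌢-shift : ∀ u z j → F (u ⌢ z) (W z u + j) ≡ F z j
  F-⌢-shift u z j = trans (F-shift (u ⌢ z) (length u) j) (F-cong (⌢-drop u) j)

  seg-image : ∀ x m → seg (F x) 0 (N x m) ≡ image (σ m x) (seg x 0 m)
  seg-image x zero = refl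
  seg-image x (suc m) = trans (seg-concatAt (λ i → f (window θ x i)) (N (σ 1 x) m))
    (cong₂ _++_ (sym (block-cong (≗⇒≈ (seg-⌢ x (suc m))))) (seg-image (σ 1 x) m))

  -- Images of edited words

  module Bounded (M : ℕ) (block≤M : ∀ x → length (block x) ≤ M) where

    -- The cost of one deletion: its own window and the θ windows that may see it.
    unit : ℕ
    unit = M + (M + M) * θ

    -- The term (M + M) * g is a potential: g letters of agreement have been
    -- charged so far, and once g = θ the next windows coincide and are free.
    image-Lev-potential : Lev d u v → ∀ z z' → ∃ λ g → g ≤ θ × ((u ⌢ z) ≈[ g ] (v ⌢ z')) ×
      Lev (d * unit + (M + M) * g) (image z u) (image z' v)
    image-Lev-potential done z z' = 0 , z≤n , (λ _ ()) , done
    image-Lev-potential {d = d} {u = a ∷ u} {v = a ∷ v} (keep p) z z' with image-Lev-potential p z z'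
    ... | g , g≤θ , agree , q with m≤n⇒m<n∨m≡n g≤θ
    ...   | inj₁ g<θ = suc g , g<θ , agree' ,
      Lev-mono (≤-trans (+-monoˡ-≤ _ (+-mono-≤ (block≤M ((a ∷ u) ⌢ z)) (block≤M ((a ∷ v) ⌢ z'))))
          (≤-reflexive (lem (d * unit) M g)))
        (Lev-++ (Lev-total (block ((a ∷ u) ⌢ z)) (block ((a ∷ v) ⌢ z'))) q)
      where
      agree' : ((a ∷ u) ⌢ z) ≈[ suc g ] ((a ∷ v) ⌢ z')
      agree' zero _ = refl
      agree' (suc j) (s≤s j<) = agree j j<
      lem : ∀ D M g → M + M + (D + (M + M) * g) ≡ D + (M + M) * suc g
      lem = solve-∀
    ...   | inj₂ refl = g , g≤θ , agree' ,
      subst (λ w → Lev (d * unit + (M + M) * g) (block ((a ∷ u) ⌢ z) ++ image z u) (w ++ image z' v))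
        (block-cong agree')
        (Lev-++ (Lev-refl (block ((a ∷ u) ⌢ z))) q)
      where
      agree' : ((a ∷ u) ⌢ z) ≈[ g ] ((a ∷ v) ⌢ z')
      agree' zero _ = refl
      agree' (suc j) j< = agree j (<-trans (n<1+n j) j<)
    -- A deletion breaks the agreement, so `g` restarts at 0; the potential accumulated so far, at
    -- most `(M + M) * θ`, is absorbed into the new `unit`.
    image-Lev-potential {d = suc d} {u = a ∷ u} (delˡ p) z z' with image-Lev-potential p z z'
    ... | g , g≤θ , _ , q = 0 , z≤n , (λ _ ()) , Lev-mono
      (≤-trans (+-mono-≤ (block≤M ((a ∷ u) ⌢ z)) (+-monoʳ-≤ (d * unit) (*-monoʳ-≤ (M + M) g≤θ)))
        (≤-reflexive (lem M (d * unit) ((M + M) * θ) (M + M))))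
      (Lev-trans (Lev-dropˡ (block ((a ∷ u) ⌢ z)) _) q)
      where
      lem : ∀ M D T M' → M + (D + T) ≡ M + T + D + M' * 0
      lem = solve-∀
    image-Lev-potential {d = suc d} {v = a ∷ u} (delʳ p) z z' with image-Lev-potential p z z'
    ... | g , g≤θ , _ , q = 0 , z≤n , (λ _ ()) , Lev-mono
      (≤-trans (+-mono-≤ (block≤M ((a ∷ u) ⌢ z')) (+-monoʳ-≤ (d * unit) (*-monoʳ-≤ (M + M) g≤θ)))
        (≤-reflexive (lem M (d * unit) ((M + M) * θ) (M + M))))
      (Lev-sym (Lev-trans (Lev-dropˡ (block ((a ∷ u) ⌢ z')) _) (Lev-sym q)))
      where
      lem : ∀ M D T M' → M + (D + T) ≡ M + T + D + M' * 0
      lem = solve-∀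

    -- `N` turns positions of `x` and `y` into positions of their images; the extra `(M + M) * θ`
    -- bounds the potential left at the beginning of the segment.
    F-Lev : ∀ x y i m → Lev d (seg x i m) (seg y i m) →
      Lev (d * unit + (M + M) * θ) (seg (F x) (N x i) (N (σ i x) m)) (seg (F y) (N y i) (N (σ i y) m))
    F-Lev {d = d} x y i m p with image-Lev-potential p (σ m (σ i x)) (σ m (σ i y))
    ... | g , g≤θ , _ , q = subst₂ (Lev _) (eq x) (eq y)
      (Lev-mono (+-monoʳ-≤ (d * unit) (*-monoʳ-≤ (M + M) g≤θ)) q)
      where
      eq : ∀ x → image (σ m (σ i x)) (seg x i m) ≡ seg (F x) (N x i) (N (σ i x) m)
      eq x = trans (sym (seg-image (σ i x) m))
        (seg-cong (N (σ i x) m) (λ j _ → sym (F-shift x i j)))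

-- Diamonds and the growth rate of images

take-length-++ : ∀ (u v : List A) → take (length u) (u ++ v) ≡ u
take-length-++ [] v = refl
take-length-++ (c ∷ u) v = cong (c ∷_) (take-length-++ u v)

drop-length-++ : ∀ (u v : List A) → drop (length u) (u ++ v) ≡ v
drop-length-++ [] v = refl
drop-length-++ (c ∷ u) v = drop-length-++ u v

takeVec-⌢ : ∀ n (u : List A) z → n ≤ length u → takeVec n u ≡ just (window n (u ⌢ z) 0)
takeVec-⌢ zero u z _ = refl
takeVec-⌢ (suc n) (c ∷ u) z (s≤s n≤) = cong (Maybe.map (c Data.Vec.∷_)) (takeVec-⌢ n u z n≤)

module Padding {A : Set} (o : A) (θ : ℕ) (1≤θ : 1 ≤ θ) (f : Vec A θ → List⁺ A) where

  open DillMap θ f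

  0∞ : Seq A
  0∞ _ = o

  κ : ℕ
  κ = length (block 0∞)

  W0 : List A → ℕ
  W0 = W 0∞

  -- The windows that start in s ++ [ a ] weigh the same as if a were o. By
  -- telescoping, N x i is then i * κ up to terms that depend on x near 0 and i.
  Level : Set
  Level = ∀ s → length s ≡ θ → ∀ a → W0 (s ++ [ a ]) ≡ W0 s + κ

  fstar-step : ∀ c u z → θ ≤ length (c ∷ u) → fstar θ f (c ∷ u) ≡ block ((c ∷ u) ⌢ z) ++ fstar θ f u
  fstar-step c u z le rewrite takeVec-⌢ θ (c ∷ u) z le = refl

  -- As `v` fills a whole window, every window that starts in `u` fits into `u ++ v`, so `fstar`
  -- meets all the windows that `W` counts.
  fstar-++ : ∀ u v z → θ ≤ length v → length (fstar θ f (u ++ v)) ≡ W (v ⌢ z) u + length (fstar θ f v)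
  fstar-++ [] v z le = refl
  fstar-++ (c ∷ u) v z le = begin
    length (fstar θ f (c ∷ u ++ v))
      ≡⟨ cong length (fstar-step c (u ++ v) z
           (≤-trans le (≤-trans (m≤n+m _ (suc (length u))) (≤-reflexive (sym (length-++ (c ∷ u))))))) ⟩
    length (block ((c ∷ u ++ v) ⌢ z) ++ fstar θ f (u ++ v))
      ≡⟨ length-++ (block ((c ∷ u ++ v) ⌢ z)) ⟩
    length (block ((c ∷ u ++ v) ⌢ z)) + length (fstar θ f (u ++ v))
      ≡⟨ cong₂ _+_ (cong length (block-cong (≗⇒≈ (⌢-++ (c ∷ u) v)))) (fstar-++ u v z le) ⟩
    length (block ((c ∷ u) ⌢ v ⌢ z)) + (W (v ⌢ z) u + length (fstar θ f v))
      ≡⟨ sym (+-assoc (length (block ((c ∷ u) ⌢ v ⌢ z))) _ _) ⟩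
    W (v ⌢ z) (c ∷ u) + length (fstar θ f v) ∎
    where open ≡-Reasoning

  zeros-⌢ : ∀ n {z} → (replicate n o ⌢ z) ≈[ n ] 0∞
  zeros-⌢ (suc n) zero _ = refl
  zeros-⌢ (suc n) (suc j) (s≤s j<) = zeros-⌢ n j j<

  W0-snoc-o : ∀ s → W0 (s ++ [ o ]) ≡ W0 s + κ
  W0-snoc-o s = trans (W-++ 0∞ s [ o ])
    (cong₂ _+_ (W-local s o⌢0∞) (trans (+-identityʳ _) (cong length (block-cong o⌢0∞))))
    where
    o⌢0∞ : ∀ {n} → ([ o ] ⌢ 0∞) ≈[ n ] 0∞
    o⌢0∞ zero _ = refl
    o⌢0∞ (suc j) _ = refl

  -- The diamond consists of `s ++ [ a ]` and `s ++ [ o ]`, each followed by `zs`. What starts in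
  -- `zs` weighs the same on both sides and cancels; for the other windows, `zs` is as good as `0∞`.
  diamond⇒level : DiamondUniform θ f → Level
  diamond⇒level du s refl a = trans (+-cancelʳ-≡ (length (fstar θ f zs)) _ _
    (trans (sym (weight a)) (trans same (weight o)))) (W0-snoc-o s)
    where
    zs = replicate θ o
    |zs| : length zs ≡ θ
    |zs| = length-replicate θ
    len : ∀ a → length ((s ++ [ a ]) ++ zs) ≡ θ + 1 + θ
    len a = trans (length-++ (s ++ [ a ])) (cong₂ _+_ (length-++ s) |zs|)
    ends : ∀ a → drop (θ + 1 + θ ∸ θ) ((s ++ [ a ]) ++ zs) ≡ zs
    ends a = subst (λ n → drop n ((s ++ [ a ]) ++ zs) ≡ zs)
      (trans (length-++ s) (sym (m+n∸n≡m (θ + 1) θ))) (drop-length-++ (s ++ [ a ]) zs)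
    starts : ∀ a → take θ ((s ++ [ a ]) ++ zs) ≡ s
    starts a = trans (cong (take θ) (++-assoc s [ a ] zs)) (take-length-++ s _)
    same = du (θ + 1 + θ) ((s ++ [ a ]) ++ zs) ((s ++ [ o ]) ++ zs) (len a) (len o)
      (trans (starts a) (sym (starts o))) (trans (ends a) (sym (ends o)))
    weight : ∀ a → length (fstar θ f ((s ++ [ a ]) ++ zs)) ≡ W0 (s ++ [ a ]) + length (fstar θ f zs)
    weight a = trans (fstar-++ (s ++ [ a ]) zs 0∞ (≤-reflexive (sym |zs|)))
      (cong (_+ _) (W-local (s ++ [ a ]) (zeros-⌢ θ)))

  module Levelled (level : Level) where

    -- The word of the first `suc θ` letters of `x` is weighed in two ways: splitting off its first
    -- window gives the left side, removing its last letter by `level` the right side.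
    level-step : ∀ x → length (block x) + W0 (seg x 1 θ) ≡ W0 (seg x 0 θ) + κ
    level-step x = begin
      length (block x) + W0 (seg x 1 θ)
        ≡⟨ cong (λ u → length u + W0 (seg x 1 θ)) (block-cong agree) ⟩
      W0 (seg x 0 (suc θ))
        ≡⟨ cong (λ n → W0 (seg x 0 n)) (+-comm 1 θ) ⟩
      W0 (seg x 0 (θ + 1))
        ≡⟨ cong W0 (seg-++ x θ 1) ⟩
      W0 (seg x 0 θ ++ [ x (θ + 0) ])
        ≡⟨ level (seg x 0 θ) (length-seg x 0 θ) _ ⟩
      W0 (seg x 0 θ) + κ ∎
      where
      open ≡-Reasoning
      agree : x ≈[ θ ] (seg x 0 (suc θ) ⌢ 0∞)
      agree = ≈-mono (≤-trans (n≤1+n θ) (≤-reflexive (sym (length-seg x 0 (suc θ)))))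
        (≈-trans (≈-sym (≗⇒≈ (seg-⌢ x (suc θ)))) (⌢-take (seg x 0 (suc θ))))

    -- By `level-step`, block length minus `κ` is a coboundary: the difference of `W0` on two
    -- successive words of θ letters.
    telescope : ∀ x i → N x i + W0 (seg x i θ) ≡ W0 (seg x 0 θ) + i * κ
    telescope x zero = sym (+-identityʳ _)
    telescope x (suc i) = begin
      length (block x) + N (σ 1 x) i + W0 (seg x (suc i) θ)
        ≡⟨ +-assoc (length (block x)) _ _ ⟩
      length (block x) + (N (σ 1 x) i + W0 (seg (σ 1 x) i θ))
        ≡⟨ cong (length (block x) +_) (telescope (σ 1 x) i) ⟩
      length (block x) + (W0 (seg x 1 θ) + i * κ)
        ≡⟨ sym (+-assoc (length (block x)) _ _) ⟩
      length (block x) + W0 (seg x 1 θ) + i * κ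
        ≡⟨ cong (_+ i * κ) (level-step x) ⟩
      W0 (seg x 0 θ) + κ + i * κ
        ≡⟨ +-assoc (W0 (seg x 0 θ)) κ _ ⟩
      W0 (seg x 0 θ) + suc i * κ ∎
      where open ≡-Reasoning

    seg-all : ∀ (u : List A) {z} → seg (u ⌢ z) 0 (length u) ≡ u
    seg-all u {z} = begin
      seg (u ⌢ z) 0 (length u)        ≡⟨ cong (seg (u ⌢ z) 0) (sym (+-identityʳ _)) ⟩
      seg (u ⌢ z) 0 (length u + 0)    ≡⟨ seg-of-⌢ u 0 ⟩
      u ++ []                         ≡⟨ ++-identityʳ u ⟩
      u                               ∎
      where open ≡-Reasoning

    seg-take : ∀ n (u : List A) {z} → n ≤ length u → seg (u ⌢ z) 0 n ≡ take n u
    seg-take zero u _ = refl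
    seg-take (suc n) (c ∷ u) (s≤s n≤) = cong (c ∷_) (seg-take n u n≤)

    seg-drop : ∀ m (u : List A) {z} → seg (u ⌢ z) m (length u ∸ m) ≡ drop m u
    seg-drop zero u = seg-all u
    seg-drop (suc m) [] = refl
    seg-drop (suc m) (c ∷ u) = seg-drop m u

    fstar-N : ∀ m u → θ ≤ length (drop m u) →
      length (fstar θ f u) ≡ N (u ⌢ 0∞) m + length (fstar θ f (drop m u))
    fstar-N zero u le = refl
    fstar-N (suc m) [] le = contradiction (≤-trans 1≤θ le) λ ()
    fstar-N (suc m) (c ∷ u) le = begin
      length (fstar θ f (c ∷ u))
        ≡⟨ cong length (fstar-step c u 0∞ (≤-trans le (≤-trans
             (≤-reflexive (length-drop m u)) (≤-trans (m∸n≤m _ m) (n≤1+n _))))) ⟩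
      length (block ((c ∷ u) ⌢ 0∞) ++ fstar θ f u)
        ≡⟨ length-++ (block ((c ∷ u) ⌢ 0∞)) ⟩
      length (block ((c ∷ u) ⌢ 0∞)) + length (fstar θ f u)
        ≡⟨ cong (length (block ((c ∷ u) ⌢ 0∞)) +_) (fstar-N m u le) ⟩
      length (block ((c ∷ u) ⌢ 0∞)) + (N (u ⌢ 0∞) m + length (fstar θ f (drop m u)))
        ≡⟨ sym (+-assoc (length (block ((c ∷ u) ⌢ 0∞))) _ _) ⟩
      N ((c ∷ u) ⌢ 0∞) (suc m) + length (fstar θ f (drop m u)) ∎
      where open ≡-Reasoning

    -- By `telescope`, the weight of the windows before the last one is determined by the length and
    -- by the first and last θ letters.
    level⇒diamond : DiamondUniform θ f
    level⇒diamond ℓ u v |u| |v| takes drops with ≤-total θ ℓ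
    -- Here `ℓ ∸ θ` is 0, so the common suffix is the whole word.
    ... | inj₂ ℓ≤θ = cong (λ w → length (fstar θ f w))
      (trans (sym (whole u |u|)) (trans drops (whole v |v|)))
      where
      whole : ∀ u → length u ≡ ℓ → drop (ℓ ∸ θ) u ≡ u
      whole u |u| = cong (λ n → drop n u) (m≤n⇒m∸n≡0 ℓ≤θ)
    ... | inj₁ θ≤ℓ = begin
      length (fstar θ f u)
        ≡⟨ fstar-N i u (long u |u|) ⟩
      N (u ⌢ 0∞) i + length (fstar θ f (drop i u))
        ≡⟨ cong₂ _+_ N-eq (cong (λ w → length (fstar θ f w)) drops) ⟩
      N (v ⌢ 0∞) i + length (fstar θ f (drop i v))
        ≡⟨ sym (fstar-N i v (long v |v|)) ⟩
      length (fstar θ f v) ∎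
      where
      open ≡-Reasoning
      i : ℕ
      i = ℓ ∸ θ
      long : ∀ u → length u ≡ ℓ → θ ≤ length (drop i u)
      long u refl = ≤-reflexive (sym (trans (length-drop i u) (m∸[m∸n]≡n θ≤ℓ)))
      N-formula : ∀ u → length u ≡ ℓ → N (u ⌢ 0∞) i + W0 (drop i u) ≡ W0 (take θ u) + i * κ
      N-formula u refl = trans
        (cong (λ w → N (u ⌢ 0∞) i + W0 w)
          (trans (sym (seg-drop i u)) (cong (seg (u ⌢ 0∞) i) (m∸[m∸n]≡n θ≤ℓ))))
        (trans (telescope (u ⌢ 0∞) i) (cong (λ w → W0 w + i * κ) (seg-take θ u θ≤ℓ)))
      N-eq : N (u ⌢ 0∞) i ≡ N (v ⌢ 0∞) i
      N-eq = +-cancelʳ-≡ (W0 (drop i u)) _ _ (trans (N-formula u |u|)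
        (trans (cong (λ w → W0 w + i * κ) takes)
        (trans (sym (N-formula v |v|)) (cong (λ w → N (v ⌢ 0∞) i + W0 w) (sym drops)))))

    module _ (M : ℕ) (block≤M : ∀ x → length (block x) ≤ M) where

      open Bounded M block≤M

      N≤ : ∀ x i → N x i ≤ i * M
      N≤ x zero = z≤n
      N≤ x (suc i) = +-mono-≤ (block≤M x) (N≤ (σ 1 x) i)

      W0≤ : ∀ x i → W0 (seg x i θ) ≤ θ * M
      W0≤ x i = ≤-trans (N≤ (seg x i θ ⌢ 0∞) (length (seg x i θ))) (≤-reflexive (cong (_* M) (length-seg x i θ)))

      -- Both boundary terms in `telescope` are at most `θ * M`.
      N-near : ∀ x i → Near (θ * M) (i * κ) (N x i)
      N-near x i =
        ≤-trans (m≤n+m _ (W0 (seg x 0 θ)))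
          (≤-trans (≤-reflexive (sym (telescope x i))) (+-monoʳ-≤ (N x i) (W0≤ x i))) ,
        ≤-trans (m≤m+n _ (W0 (seg x i θ)))
          (≤-trans (≤-reflexive (trans (telescope x i) (+-comm _ (i * κ)))) (+-monoʳ-≤ (i * κ) (W0≤ x 0)))

      instance
        κ-nonZero : NonZero κ
        κ-nonZero = >-nonZero (1≤length⁺ (f (window θ 0∞ 0)))

      /-near : ∀ k → Near κ k (k / κ * κ)
      /-near k =
        ≤-trans (≤-reflexive (trans (m≡m%n+[m/n]*n k κ) (+-comm (k % κ) _)))
          (+-monoʳ-≤ (k / κ * κ) (<⇒≤ (m%n<n k κ))) ,
        ≤-trans (m≤n+m _ (k % κ)) (≤-trans (≤-reflexive (sym (m≡m%n+[m/n]*n k κ))) (m≤m+n k κ))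

      -- Up to a bounded shift, the letters of `F x` from `k` on come from those of `x` from `k / κ`
      -- on, and likewise for `y`. So `F-Lev` applies to segments of `x` and `y` at the same
      -- position.
      level⇒compatible : WLCompatible F
      level⇒compatible x y h = LevWL0⇒WL0 (F x) (F y) (LevWL0-affine (F x) (F y) unit close)
        where
        -- Rounding to a multiple of `κ` costs `κ`, and `N-near` costs `θ * M`. Moving the start of
        -- a segment by at most `r` takes `r + r` deletions, adjusting its length `r` more, and this
        -- is done for both images.
        r = κ + θ * M
        K = (M + M) * θ + 2 * (r + r + r)
        align : ∀ x k ℓ → Lev (r + r + r) (seg (F x) k ℓ) (seg (F x) (N x (k / κ)) (N (σ (k / κ) x) (ℓ / κ)))
        align x k ℓ = Lev-trans
          (seg-Lev-start (F x) ℓ (Near-trans (/-near k) (N-near x (k / κ))))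
          (seg-Lev-length (F x) (N x (k / κ)) (Near-trans (/-near ℓ) (N-near (σ (k / κ) x) (ℓ / κ))))
        close : ∀ q → ∃ λ K → ∀ ℓ → K ≤ ℓ → ∀ k →
          ∃ λ d → Lev (d * unit + K) (seg (F x) k ℓ) (seg (F y) k ℓ) × d * q ≤ ℓ + K
        close q with WL0⇒LevWL0 x y h q
        -- The summand `L * κ` makes `ℓ / κ` at least `L`.
        ... | L , h' = K + L * κ , λ ℓ K≤ℓ k →
          let L≤m = ≤-trans (≤-reflexive (sym (m*n/n≡m L κ))) (/-monoˡ-≤ κ (≤-trans (m≤n+m _ K) K≤ℓ))
              (d , p , le) = h' (ℓ / κ) L≤m (k / κ) in
          d ,
          Lev-mono (≤-trans (≤-reflexive (total (d * unit) ((M + M) * θ) (r + r + r)))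
              (+-monoʳ-≤ (d * unit) (m≤m+n K _)))
            (Lev-trans (align x k ℓ) (Lev-trans (F-Lev x y (k / κ) (ℓ / κ) p) (Lev-sym (align y k ℓ)))) ,
          ≤-trans le (≤-trans (m/n≤m ℓ κ) (m≤m+n ℓ _))
          where
          total : ∀ D P R → R + (D + P + R) ≡ D + (P + 2 * R)
          total = solve-∀

-- Sequences with sparse differences

-- On the first m positions any two differences are more than R apart, and the
-- first c positions show none.
data Sparse {A : Set} (R : ℕ) : ℕ → ℕ → Seq A → Seq A → Set where
  stop : Sparse R c zero x y
  same : x 0 ≡ y 0 → Sparse R (pred c) m (σ 1 x) (σ 1 y) → Sparse R c (suc m) x y
  diff : Sparse R R m (σ 1 x) (σ 1 y) → Sparse R 0 (suc m) x y

Sparse-cong : ∀ {x' y' : Seq A} → x ≗ x' → y ≗ y' → Sparse R c m x y → Sparse R c m x' y'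
Sparse-cong p q stop = stop
Sparse-cong p q (same eq s) = same (trans (sym (p 0)) (trans eq (q 0)))
  (Sparse-cong (λ j → p (suc j)) (λ j → q (suc j)) s)
Sparse-cong p q (diff s) = diff (Sparse-cong (λ j → p (suc j)) (λ j → q (suc j)) s)

Sparse-weaken : d ≤ c → Sparse R c m x y → Sparse R d m x y
Sparse-weaken d≤c stop = stop
Sparse-weaken d≤c (same eq s) = same eq (Sparse-weaken (pred-mono-≤ d≤c) s)
Sparse-weaken z≤n (diff s) = diff s

Sparse-take : n ≤ m → Sparse R c m x y → Sparse R c n x y
Sparse-take z≤n s = stop
Sparse-take (s≤s n≤m) (same eq s) = same eq (Sparse-take n≤m s)
Sparse-take (s≤s n≤m) (diff s) = diff (Sparse-take n≤m s)

Sparse-drop : ∀ k → Sparse R c (k + m) x y → Sparse R 0 m (σ k x) (σ k y)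
Sparse-drop zero s = Sparse-weaken z≤n s
Sparse-drop (suc k) (same _ s) = Sparse-drop k s
Sparse-drop (suc k) (diff s) = Sparse-drop k s

-- Each difference takes two deletions and is charged to `suc R` positions, itself and the next `R`.
-- The last charge may extend past `m`, hence `+ R`; the first `c` positions are already charged to
-- an earlier difference.
Sparse-Lev : c ≤ R → Sparse R c m x y →
  ∃ λ d → Lev (d * 2) (seg x 0 m) (seg y 0 m) × d * suc R + c ≤ m + R
Sparse-Lev c≤R stop = 0 , done , c≤R
Sparse-Lev {c = c} {R = R} {m = suc m} {x = x} {y = y} c≤R (same eq s)
  with Sparse-Lev (≤-trans pred[n]≤n c≤R) s
... | d , p , le = d ,
  subst (λ a → Lev (d * 2) (x 0 ∷ seg x 1 m) (a ∷ seg y 1 m)) eq (keep p) ,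
  ≤-trans (+-monoʳ-≤ (d * suc R) (suc-pred-≤ c))
    (≤-trans (≤-reflexive (+-suc (d * suc R) (pred c))) (s≤s le))
  where
  suc-pred-≤ : ∀ c → c ≤ suc (pred c)
  suc-pred-≤ zero = z≤n
  suc-pred-≤ (suc c) = ≤-refl
Sparse-Lev {R = R} {m = suc m} c≤R (diff s) with Sparse-Lev ≤-refl s
... | d , p , le = suc d , delˡ (delʳ p) ,
  s≤s (≤-trans (≤-reflexive (trans (+-identityʳ _) (+-comm R (d * suc R)))) le)

-- A block accepts any gap `c` still open on its left, provided its continuation starts with a full
-- gap `R`. Quantifying over continuations makes concatenation of blocks a composition of functions.
SparseBlock : {A : Set} → ℕ → List A → List A → Set
SparseBlock {A} R u v = length u ≡ length v ×
  (∀ {c m} {z z' : Seq A} → c ≤ R → Sparse R R m z z' → Sparse R c (length u + m) (u ⌢ z) (v ⌢ z'))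

Sparse-⌢ : ∀ (u : List A) {c} → Sparse R (c ∸ length u) m x y → Sparse R c (length u + m) (u ⌢ x) (u ⌢ y)
Sparse-⌢ [] s = s
Sparse-⌢ (a ∷ u) {zero} s = same refl (Sparse-⌢ u (Sparse-weaken (m∸n≤m 0 (length u)) s))
Sparse-⌢ (a ∷ u) {suc c} s = same refl (Sparse-⌢ u s)

SparseBlock-refl : ∀ (u : List A) → SparseBlock R u u
SparseBlock-refl u = refl , λ c≤R s → Sparse-⌢ u (Sparse-weaken (≤-trans (m∸n≤m _ (length u)) c≤R) s)

SparseBlock-++ : ∀ {u' v' : List A} → SparseBlock R u v → SparseBlock R u' v' →
  SparseBlock R (u ++ u') (v ++ v')
SparseBlock-++ {u = u} {v = v} {u' = u'} {v' = v'} (p , s) (p' , s') =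
  trans (length-++ u) (trans (cong₂ _+_ p p') (sym (length-++ v))) ,
  λ {c} {m} c≤R t → Sparse-take
    (≤-reflexive (trans (cong (_+ m) (length-++ u)) (+-assoc (length u) (length u') m)))
    (Sparse-cong (λ j → sym (⌢-++ u u' j)) (λ j → sym (⌢-++ v v' j)) (s c≤R (s' ≤-refl t)))

-- The letters of `u` close any gap still open, so a difference may follow them.
SparseBlock-snoc : ∀ (u : List A) a b → R ≤ length u → SparseBlock R (u ++ [ a ]) (u ++ [ b ])
SparseBlock-snoc {R = R} u a b R≤ =
  trans (length-++ u) (sym (length-++ u)) ,
  λ {c} {m} {z} {z'} c≤R t → Sparse-take
    (≤-reflexive (trans (cong (_+ m) (length-++ u)) (+-assoc (length u) 1 m)))
    (Sparse-cong (λ j → sym (⌢-++ u [ a ] j)) (λ j → sym (⌢-++ u [ b ] j))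
      (Sparse-⌢ u (subst (λ i → Sparse R i (suc m) ([ a ] ⌢ z) ([ b ] ⌢ z'))
        (sym (m≤n⇒m∸n≡0 (≤-trans c≤R R≤))) (diff t))))

rep : ℕ → List A → List A
rep zero u = []
rep (suc t) u = u ++ rep t u

SparseBlock-rep : ∀ t → SparseBlock R u v → SparseBlock R (rep t u) (rep t v)
SparseBlock-rep zero s = SparseBlock-refl []
SparseBlock-rep {u = u} {v = v} (suc t) s = SparseBlock-++ {u = u} {v = v} s (SparseBlock-rep t s)

concatAt-Sparse : ∀ m (g h : ℕ → List⁺ A) → (∀ i → SparseBlock R (toList⁺ (g i)) (toList⁺ (h i))) →
  Sparse R R m (concatAt g) (concatAt h)
concatAt-Sparse zero g h s = stop
concatAt-Sparse (suc m) g h s = Sparse-take (+-monoˡ-≤ m (1≤length⁺ (g 0)))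
  (Sparse-cong (λ j → sym (concatAt-⌢ g j)) (λ j → sym (concatAt-⌢ h j))
    (proj₂ (s 0) ≤-refl (concatAt-Sparse m (λ i → g (suc i)) (λ i → h (suc i)) (λ i → s (suc i)))))

concatAt-shift : ∀ r (g h : ℕ → List⁺ A) → (∀ i → length (toList⁺ (g i)) ≡ length (toList⁺ (h i))) →
  ∃ λ E → (σ E (concatAt g) ≗ concatAt (λ i → g (r + i))) × (σ E (concatAt h) ≗ concatAt (λ i → h (r + i)))
concatAt-shift zero g h eq = 0 , (λ _ → refl) , (λ _ → refl)
concatAt-shift (suc r) g h eq with concatAt-shift r (λ i → g (suc i)) (λ i → h (suc i)) (λ i → eq (suc i))
... | E , p , q = length (toList⁺ (g 0)) + E ,
  (λ j → trans (step g j) (p j)) ,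
  (λ j → trans (cong (λ n → concatAt h (n + E + j)) (eq 0)) (trans (step h j) (q j)))
  where
  step : ∀ g j → concatAt g (length (toList⁺ (g 0)) + E + j) ≡ concatAt (λ i → g (suc i)) (E + j)
  step g j = trans (cong (concatAt g) (+-assoc (length (toList⁺ (g 0))) E j))
    (trans (concatAt-⌢ g (length (toList⁺ (g 0)) + (E + j))) (⌢-drop (toList⁺ (g 0)) (E + j)))

-- For precision `q`, the blocks from index `q` on are sparse enough, and the earlier ones occupy
-- `E` letters, a constant that `LevWL0-affine` absorbs.
concatAt-LevWL0 : ∀ (g h : ℕ → List⁺ A) →
  (∀ R i → R ≤ i → SparseBlock R (toList⁺ (g i)) (toList⁺ (h i))) → LevWL0 (concatAt g) (concatAt h)
concatAt-LevWL0 g h s = LevWL0-affine (concatAt g) (concatAt h) 2 close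
  where
  close : ∀ q → ∃ λ K → ∀ ℓ → K ≤ ℓ → ∀ k →
    ∃ λ d → Lev (d * 2 + K) (seg (concatAt g) k ℓ) (seg (concatAt h) k ℓ) × d * q ≤ ℓ + K
  close q with concatAt-shift q g h (λ i → proj₁ (s 0 i z≤n))
  ... | E , eqg , eqh = E + E + q , far
    where
    rest : (ℕ → List⁺ _) → Seq _
    rest g = concatAt (λ i → g (q + i))
    seg-split : ∀ g → σ E (concatAt g) ≗ rest g → ∀ k n →
      seg (concatAt g) k (E + n) ≡ seg (concatAt g) k E ++ seg (rest g) k n
    seg-split g eq k n = trans (seg-++ (σ k (concatAt g)) E n)
      (cong (seg (concatAt g) k E ++_) (seg-cong n (λ j _ →
        trans (cong (concatAt g) (swap k E j)) (eq (k + j)))))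
      where
      swap : ∀ a b j → a + (b + j) ≡ b + (a + j)
      swap = solve-∀
    far : ∀ ℓ → E + E + q ≤ ℓ → ∀ k →
      ∃ λ d → Lev (d * 2 + (E + E + q)) (seg (concatAt g) k ℓ) (seg (concatAt h) k ℓ) × d * q ≤ ℓ + (E + E + q)
    -- The first `E` letters of the segment are given up wherever it starts; the remaining `n` then
    -- lie beyond the early blocks for every `k`.
    far ℓ K≤ℓ k with m≤n⇒∃[o]m+o≡n (≤-trans (≤-trans (m≤m+n E E) (m≤m+n _ q)) K≤ℓ)
    ... | n , refl with Sparse-Lev z≤n (Sparse-drop k (concatAt-Sparse (k + n) (λ i → g (q + i)) (λ i → h (q + i))
                          (λ i → s q (q + i) (m≤m+n q i))))
    ...   | d , p , le = d ,
      subst₂ (Lev (d * 2 + (E + E + q))) (sym (seg-split g eqg k n)) (sym (seg-split h eqh k n))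
        (Lev-mono (≤-trans (≤-reflexive (+-comm (E + E) (d * 2))) (+-monoʳ-≤ (d * 2) (m≤m+n _ q)))
          (Lev-++ (subst₂ (λ a b → Lev (a + b) (seg (concatAt g) k E) (seg (concatAt h) k E))
            (length-seg (concatAt g) k E) (length-seg (concatAt h) k E) (Lev-total _ _)) p)) ,
      ≤-trans (*-monoʳ-≤ d (n≤1+n q)) (≤-trans (m≤m+n _ 0) (≤-trans le
        (+-mono-≤ (m≤n+m n E) (m≤n+m q (E + E)))))

-- Sequences built from an unbalanced diamond

nonEmpty : ∀ {A : Set} (u : List A) → 1 ≤ length u → ∃ λ v → toList⁺ v ≡ u
nonEmpty (a ∷ u) _ = a ∷ u , refl

module Clean {A : Set} (o : A) (θ : ℕ) (1≤θ : 1 ≤ θ) (f : Vec A θ → List⁺ A) where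

  open DillMap θ f
  open Padding o θ 1≤θ f

  zeros : List A
  zeros = replicate θ o

  -- The leading zeros hide `u` from the windows that start before them, so weights of concatenated
  -- padded words add up.
  pad : List A → List A
  pad u = zeros ++ u

  pad-⌢ : ∀ u {z} → (pad u ⌢ z) ≈[ θ ] 0∞
  pad-⌢ u = ≈-trans (≗⇒≈ (⌢-++ zeros u)) (zeros-⌢ θ)

  rep-pad-⌢ : ∀ t u {z} → z ≈[ θ ] 0∞ → (rep t (pad u) ⌢ z) ≈[ θ ] 0∞
  rep-pad-⌢ zero u p = p
  rep-pad-⌢ (suc t) u p =
    ≈-trans (≗⇒≈ (⌢-++ (pad u) (rep t (pad u)))) (pad-⌢ u)

  W-++-clean : ∀ z u v → (v ⌢ z) ≈[ θ ] 0∞ → W z (u ++ v) ≡ W0 u + W z v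
  W-++-clean z u v p = trans (W-++ z u v) (cong (_+ W z v) (W-local u p))

  W-rep : ∀ t u z → z ≈[ θ ] 0∞ → W z (rep t (pad u)) ≡ t * W0 (pad u)
  W-rep zero u z p = refl
  W-rep (suc t) u z p = trans (W-++-clean z (pad u) (rep t (pad u)) (rep-pad-⌢ t u p))
    (cong (W0 (pad u) +_) (W-rep t u z p))

  W-rep-++ : ∀ t u v z → (v ⌢ z) ≈[ θ ] 0∞ → W z (rep t (pad u) ++ v) ≡ t * W0 (pad u) + W z v
  W-rep-++ t u v z p = trans (W-++ z (rep t (pad u)) v) (cong (_+ W z v) (W-rep t u (v ⌢ z) p))

  rep-pad-++-⌢ : ∀ t u v {z} → (v ⌢ z) ≈[ θ ] 0∞ → ((rep t (pad u) ++ v) ⌢ z) ≈[ θ ] 0∞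
  rep-pad-++-⌢ t u v p = ≈-trans (≗⇒≈ (⌢-++ (rep t (pad u)) v)) (rep-pad-⌢ t u p)

  CleanBlocks : (ℕ → List⁺ A) → Set
  CleanBlocks g = ∀ i z → (toList⁺ (g i) ⌢ z) ≈[ θ ] 0∞

  -- Blocks of equal weight leave both images at the same position, although the images themselves
  -- may differ.
  F-concatAt-shift : ∀ r (g h : ℕ → List⁺ A) → CleanBlocks g → CleanBlocks h →
    (∀ i → W0 (toList⁺ (g i)) ≡ W0 (toList⁺ (h i))) →
    ∃ λ K → (σ K (F (concatAt g)) ≗ F (concatAt (λ i → g (r + i)))) ×
            (σ K (F (concatAt h)) ≗ F (concatAt (λ i → h (r + i))))
  F-concatAt-shift zero g h _ _ _ = 0 , (λ _ → refl) , (λ _ → refl)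
  F-concatAt-shift (suc r) g h cg ch eq with
    F-concatAt-shift r (λ i → g (suc i)) (λ i → h (suc i)) (λ i → cg (suc i)) (λ i → ch (suc i)) (λ i → eq (suc i))
  ... | K , p , q = W0 (toList⁺ (g 0)) + K ,
    (λ j → trans (step g cg j) (p j)) ,
    (λ j → trans (cong (λ n → F (concatAt h) (n + K + j)) (eq 0)) (trans (step h ch j) (q j)))
    where
    step : ∀ g → CleanBlocks g → ∀ j →
      F (concatAt g) (W0 (toList⁺ (g 0)) + K + j) ≡ F (concatAt (λ i → g (suc i))) (K + j)
    step g cg j = begin
      F (concatAt g) (W0 g₀ + K + j)
        ≡⟨ cong (F (concatAt g)) (+-assoc (W0 g₀) K j) ⟩
      F (concatAt g) (W0 g₀ + (K + j))
        ≡⟨ F-cong (concatAt-⌢ g) (W0 g₀ + (K + j)) ⟩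
      F (g₀ ⌢ z) (W0 g₀ + (K + j))
        ≡⟨ cong (λ n → F (g₀ ⌢ z) (n + (K + j))) (W-local g₀ (≈-sym z-clean)) ⟩
      F (g₀ ⌢ z) (W z g₀ + (K + j))
        ≡⟨ F-⌢-shift g₀ z (K + j) ⟩
      F z (K + j) ∎
      where
      open ≡-Reasoning
      g₀ : List A
      g₀ = toList⁺ (g 0)
      z : Seq A
      z = concatAt (λ i → g (suc i))
      z-clean : z ≈[ θ ] 0∞
      z-clean = ≈-trans (≗⇒≈ (concatAt-⌢ (λ i → g (suc i)))) (cg 1 _)

  module Unlevel (s : List A) (|s| : length s ≡ θ) (b c : A) (δ : ℕ)
    (gap : W0 (s ++ [ c ]) ≡ W0 (s ++ [ b ]) + suc δ) (x y : Seq A) where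

    -- The run of `r` letters `o` keeps the replaced letters of phase `r` more than `r` apart, so
    -- replacements thin out along the sequence.
    site : ℕ → A → List A
    site r l = pad (replicate r o ++ s ++ [ l ])

    -- As `s` has θ letters, the replaced letter is out of sight of the windows that start before
    -- `s`, and only `gap` contributes.
    W0-site : ∀ r → W0 (site r c) ≡ W0 (site r b) + suc δ
    W0-site r = begin
      W0 (site r c)
        ≡⟨ split c ⟩
      W ((s ++ [ c ]) ⌢ 0∞) p + W0 (s ++ [ c ])
        ≡⟨ cong₂ _+_ (W-local p agree) gap ⟩
      W ((s ++ [ b ]) ⌢ 0∞) p + (W0 (s ++ [ b ]) + suc δ)
        ≡⟨ sym (+-assoc (W ((s ++ [ b ]) ⌢ 0∞) p) _ _) ⟩
      W ((s ++ [ b ]) ⌢ 0∞) p + W0 (s ++ [ b ]) + suc δ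
        ≡⟨ cong (_+ suc δ) (sym (split b)) ⟩
      W0 (site r b) + suc δ ∎
      where
      open ≡-Reasoning
      p : List A
      p = zeros ++ replicate r o
      split : ∀ l → W0 (site r l) ≡ W ((s ++ [ l ]) ⌢ 0∞) p + W0 (s ++ [ l ])
      split l = trans (cong W0 (sym (++-assoc zeros (replicate r o) (s ++ [ l ])))) (W-++ 0∞ p (s ++ [ l ]))
      agree : ((s ++ [ c ]) ⌢ 0∞) ≈[ θ ] ((s ++ [ b ]) ⌢ 0∞)
      agree = subst (λ n → ((s ++ [ c ]) ⌢ 0∞) ≈[ n ] ((s ++ [ b ]) ⌢ 0∞)) |s|
        (≈-trans (≗⇒≈ (⌢-++ s [ c ])) (≈-trans (⌢-take s) (≈-sym (≗⇒≈ (⌢-++ s [ b ])))))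

    xs ys : ℕ → List A
    xs r = seg x 0 (r + θ)
    ys r = seg y 0 (r + θ)

    -- The number of sites in each group. Each replacement moves the image by `suc δ`, so `shift r`
    -- of them bridge exactly `suc δ` copies of `pad (ys r)`. Repeating `ys r` this often avoids any
    -- divisibility condition on the distance.
    shift : ℕ → ℕ
    shift r = W0 (pad (ys r))

    phase : ℕ → A → A → List A
    phase r l l' = pad (rep (shift r) (site r l) ++ rep (suc δ) (pad (ys r)) ++
      pad (xs r) ++ rep (shift r) (site r l'))

    phase-clean : ∀ r l l' z → (phase r l l' ⌢ z) ≈[ θ ] 0∞
    phase-clean r l l' z = pad-⌢ _

    1≤length-phase : ∀ r l l' → 1 ≤ length (phase r l l')
    1≤length-phase r l l' = ≤-trans 1≤θ (≤-trans (≤-reflexive (sym (length-replicate θ)))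
      (≤-trans (m≤m+n (length zeros) _) (≤-reflexive (sym (length-++ zeros)))))

    before-x before-y : ℕ → List A
    before-x r = pad (rep (shift r) (site r b) ++ rep (suc δ) (pad (ys r)) ++ zeros)
    before-y r = pad (rep (shift r) (site r c) ++ zeros)

    Jx Jy : ℕ
    Jx = W x zeros
    Jy = W y zeros

    phase-x : ∀ r → phase r b c ≡ before-x r ++ xs r ++ rep (shift r) (site r c)
    phase-x r = sym (begin
      (zeros ++ (B ++ Q ++ zeros)) ++ rest   ≡⟨ ++-assoc zeros _ rest ⟩
      zeros ++ (B ++ Q ++ zeros) ++ rest     ≡⟨ cong (zeros ++_) (++-assoc B _ rest) ⟩
      zeros ++ B ++ (Q ++ zeros) ++ rest     ≡⟨ cong (λ w → zeros ++ B ++ w) (++-assoc Q zeros rest) ⟩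
      zeros ++ B ++ Q ++ zeros ++ rest    ≡⟨ cong (λ w → zeros ++ B ++ Q ++ w) (sym (++-assoc zeros (xs r) _)) ⟩
      phase r b c                         ∎)
      where
      open ≡-Reasoning
      B Q rest : List A
      B = rep (shift r) (site r b)
      Q = rep (suc δ) (pad (ys r))
      rest = xs r ++ rep (shift r) (site r c)

    -- The first of the `suc δ` copies of `ys r` is singled out, since all of them lie between its
    -- start and the copy of `xs r`.
    phase-y : ∀ r → phase r c b ≡
      before-y r ++ ys r ++ rep δ (pad (ys r)) ++ pad (xs r) ++ rep (shift r) (site r b)
    phase-y r = sym (begin
      (zeros ++ (C ++ zeros)) ++ ys r ++ rest   ≡⟨ ++-assoc zeros _ _ ⟩
      zeros ++ (C ++ zeros) ++ ys r ++ rest     ≡⟨ cong (zeros ++_) (++-assoc C zeros _) ⟩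
      zeros ++ C ++ zeros ++ ys r ++ rest    ≡⟨ cong (λ w → zeros ++ C ++ w) (sym (++-assoc zeros (ys r) rest)) ⟩
      zeros ++ C ++ pad (ys r) ++ rest          ≡⟨ cong (λ w → zeros ++ C ++ w)
                                                 (sym (++-assoc (pad (ys r)) (rep δ (pad (ys r))) _)) ⟩
      phase r c b                            ∎)
      where
      open ≡-Reasoning
      C rest : List A
      C = rep (shift r) (site r c)
      rest = rep δ (pad (ys r)) ++ pad (xs r) ++ rep (shift r) (site r b)

    W0-phase : ∀ r l l' → W0 (phase r l l') ≡
      W0 zeros + (shift r * W0 (site r l) + (suc δ * shift r + (W0 (pad (xs r)) + shift r * W0 (site r l'))))
    W0-phase r l l' =
      trans (W-++-clean 0∞ zeros _ (rep-pad-++-⌢ (shift r) (site′ l) _ Q-clean)) (cong (W0 zeros +_)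
      (trans (W-rep-++ (shift r) (site′ l) _ 0∞ Q-clean) (cong (shift r * W0 (site r l) +_)
      (trans (W-rep-++ (suc δ) (ys r) _ 0∞ P-clean) (cong (suc δ * shift r +_)
      (trans (W-++-clean 0∞ (pad (xs r)) _ (rep-pad-⌢ (shift r) (site′ l') (λ _ _ → refl)))
        (cong (W0 (pad (xs r)) +_) (W-rep (shift r) (site′ l') 0∞ (λ _ _ → refl)))))))))
      where
      site′ : A → List A
      site′ l = replicate r o ++ s ++ [ l ]
      P-clean : ((pad (xs r) ++ rep (shift r) (site r l')) ⌢ 0∞) ≈[ θ ] 0∞
      P-clean = ≈-trans (≗⇒≈ (⌢-++ (pad (xs r)) _)) (pad-⌢ (xs r))
      Q-clean : ((rep (suc δ) (pad (ys r)) ++ pad (xs r) ++ rep (shift r) (site r l')) ⌢ 0∞) ≈[ θ ] 0∞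
      Q-clean = rep-pad-++-⌢ (suc δ) (ys r) _ P-clean

    phase-balanced : ∀ r → W0 (phase r b c) ≡ W0 (phase r c b)
    phase-balanced r = trans (W0-phase r b c) (trans
      (swap (W0 zeros) (shift r * W0 (site r b)) (suc δ * shift r) (W0 (pad (xs r))) (shift r * W0 (site r c)))
      (sym (W0-phase r c b)))
      where
      swap : ∀ a b q p c → a + (b + (q + (p + c))) ≡ a + (c + (q + (p + b)))
      swap = solve-∀

    W-before-x : ∀ r z → z ≈[ θ ] x →
      W z (before-x r) ≡ W0 zeros + (shift r * W0 (site r b) + (suc δ * shift r + Jx))
    W-before-x r z p =
      trans (W-++-clean z zeros _ (rep-pad-++-⌢ (shift r) _ _ Q-clean)) (cong (W0 zeros +_)
      (trans (W-rep-++ (shift r) _ _ z Q-clean) (cong (shift r * W0 (site r b) +_)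
      (trans (W-rep-++ (suc δ) (ys r) zeros z (zeros-⌢ θ)) (cong (suc δ * shift r +_)
      (W-local zeros p))))))
      where
      Q-clean : ((rep (suc δ) (pad (ys r)) ++ zeros) ⌢ z) ≈[ θ ] 0∞
      Q-clean = rep-pad-++-⌢ (suc δ) (ys r) zeros (zeros-⌢ θ)

    W-before-y : ∀ r z → z ≈[ θ ] y →
      W z (before-y r) ≡ W0 zeros + (shift r * W0 (site r c) + Jy)
    W-before-y r z p =
      trans (W-++-clean z zeros _ (rep-pad-++-⌢ (shift r) _ zeros (zeros-⌢ θ))) (cong (W0 zeros +_)
      (trans (W-rep-++ (shift r) _ zeros z (zeros-⌢ θ)) (cong (shift r * W0 (site r c) +_)
      (W-local zeros p))))

    seg-agree : ∀ (x : Seq A) r z → (seg x 0 (r + θ) ⌢ z) ≈[ r + θ ] x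
    seg-agree x r z = subst (λ n → (seg x 0 (r + θ) ⌢ z) ≈[ n ] x) (length-seg x 0 (r + θ))
      (≈-trans (⌢-take (seg x 0 (r + θ))) (≗⇒≈ (seg-⌢ x (r + θ))))

    -- The sites have moved the image of the y-copy exactly onto that of the x-copy,
    -- up to the images Jx and Jy of the transitions from zeros.
    copies : ∀ r z z' → ∃ λ P → ∃ λ P' → P + Jy ≡ P' + Jx ×
      (σ P (F (phase r b c ⌢ z)) ≈[ r ] F x) × (σ P' (F (phase r c b ⌢ z')) ≈[ r ] F y)
    copies r z z' = W (vx ⌢ z) (before-x r) , W (vy ⌢ z') (before-y r) , aligned ,
      copy x (before-x r) vx z (phase-x r) agree-x , copy y (before-y r) vy z' (phase-y r) agree-y
      where
      tx ty vx vy : List A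
      tx = rep (shift r) (site r c)
      ty = rep δ (pad (ys r)) ++ pad (xs r) ++ rep (shift r) (site r b)
      vx = xs r ++ tx
      vy = ys r ++ ty
      agree-x : (vx ⌢ z) ≈[ r + θ ] x
      agree-x = ≈-trans (≗⇒≈ (⌢-++ (xs r) tx)) (seg-agree x r (tx ⌢ z))
      agree-y : (vy ⌢ z') ≈[ r + θ ] y
      agree-y = ≈-trans (≗⇒≈ (⌢-++ (ys r) ty)) (seg-agree y r (ty ⌢ z'))
      aligned : W (vx ⌢ z) (before-x r) + Jy ≡ W (vy ⌢ z') (before-y r) + Jx
      aligned = begin
        W (vx ⌢ z) (before-x r) + Jy
          ≡⟨ cong (_+ Jy) (W-before-x r (vx ⌢ z) (≈-mono (m≤n+m θ r) agree-x)) ⟩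
        W0 zeros + (shift r * W0 (site r b) + (suc δ * shift r + Jx)) + Jy
          -- The total `suc δ * shift r` of the copies of `pad (ys r)` is redistributed as `suc δ`
          -- extra letters for each of the `shift r` sites.
          ≡⟨ arrange (W0 zeros) (shift r) (W0 (site r b)) (suc δ) Jx Jy ⟩
        W0 zeros + (shift r * (W0 (site r b) + suc δ) + Jy) + Jx
          ≡⟨ cong (λ w → W0 zeros + (shift r * w + Jy) + Jx) (sym (W0-site r)) ⟩
        W0 zeros + (shift r * W0 (site r c) + Jy) + Jx
          ≡⟨ cong (_+ Jx) (sym (W-before-y r (vy ⌢ z') (≈-mono (m≤n+m θ r) agree-y))) ⟩
        W (vy ⌢ z') (before-y r) + Jx ∎
        where
        open ≡-Reasoning
        arrange : ∀ a t w d i j → a + (t * w + (d * t + i)) + j ≡ a + (t * (w + d) + j) + i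
        arrange = solve-∀
      copy : ∀ x u v z {w} → w ≡ u ++ v → (v ⌢ z) ≈[ r + θ ] x →
        σ (W (v ⌢ z) u) (F (w ⌢ z)) ≈[ r ] F x
      copy x u v z refl p j j<r = trans (F-cong (⌢-++ u v) (W (v ⌢ z) u + j))
        (trans (F-⌢-shift u (v ⌢ z) j) (F-local r p j j<r))

    blocks : A → A → ℕ → List⁺ A
    blocks l l' r = proj₁ (nonEmpty (phase r l l') (1≤length-phase r l l'))

    toList-blocks : ∀ l l' r → toList⁺ (blocks l l' r) ≡ phase r l l'
    toList-blocks l l' r = proj₂ (nonEmpty (phase r l l') (1≤length-phase r l l'))

    blocks-clean : ∀ l l' → CleanBlocks (blocks l l')
    blocks-clean l l' r z = subst (λ u → (u ⌢ z) ≈[ θ ] 0∞) (sym (toList-blocks l l' r)) (phase-clean r l l' z)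

    blocks-balanced : ∀ r → W0 (toList⁺ (blocks b c r)) ≡ W0 (toList⁺ (blocks c b r))
    blocks-balanced r = trans (cong W0 (toList-blocks b c r))
      (trans (phase-balanced r) (cong W0 (sym (toList-blocks c b r))))

    phase-sparse : ∀ R r → R ≤ r → SparseBlock R (phase r b c) (phase r c b)
    phase-sparse R r R≤r =
      SparseBlock-++ {u = zeros} {v = zeros} (SparseBlock-refl zeros)
      (SparseBlock-++ {u = sites b} {v = sites c} (SparseBlock-rep (shift r) (site-sparse b c))
      (SparseBlock-++ {u = Q} {v = Q} (SparseBlock-refl Q)
      (SparseBlock-++ {u = pad (xs r)} {v = pad (xs r)} (SparseBlock-refl (pad (xs r)))
      (SparseBlock-rep (shift r) (site-sparse c b)))))
      where
      sites : A → List A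
      sites l = rep (shift r) (site r l)
      Q p : List A
      Q = rep (suc δ) (pad (ys r))
      p = zeros ++ replicate r o ++ s
      site-snoc : ∀ l → p ++ [ l ] ≡ site r l
      site-snoc l = trans (++-assoc zeros _ [ l ]) (cong (zeros ++_) (++-assoc (replicate r o) s [ l ]))
      R≤|p| : R ≤ length p
      R≤|p| = begin
        R                                        ≤⟨ R≤r ⟩
        r                                        ≡⟨ sym (length-replicate r) ⟩
        length (replicate r o)                   ≤⟨ m≤m+n _ (length s) ⟩
        length (replicate r o) + length s        ≡⟨ sym (length-++ (replicate r o)) ⟩
        length (replicate r o ++ s)              ≤⟨ m≤n+m _ (length zeros) ⟩
        length zeros + length (replicate r o ++ s) ≡⟨ sym (length-++ zeros) ⟩
        length p                                 ∎
        where open ≤-Reasoning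
      site-sparse : ∀ l l' → SparseBlock R (site r l) (site r l')
      site-sparse l l' = subst₂ (SparseBlock R) (site-snoc l) (site-snoc l') (SparseBlock-snoc p l l' R≤|p|)

    x′ y′ : Seq A
    x′ = concatAt (blocks b c)
    y′ = concatAt (blocks c b)

    x′y′-close : WL0 x′ y′
    x′y′-close = LevWL0⇒WL0 x′ y′ (concatAt-LevWL0 (blocks b c) (blocks c b) (λ R r R≤r →
      subst₂ (SparseBlock R) (sym (toList-blocks b c r)) (sym (toList-blocks c b r)) (phase-sparse R r R≤r)))

    -- The phases before phase `r` are balanced and hence skipped by the same `K` on both sides, so
    -- the alignment from `copies` persists.
    appears : ∀ r → ∃ λ P → ∃ λ P' → P + Jy ≡ P' + Jx × (σ P (F x′) ≈[ r ] F x) × (σ P' (F y′) ≈[ r ] F y)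
    appears r with F-concatAt-shift r (blocks b c) (blocks c b)
                     (blocks-clean b c) (blocks-clean c b) blocks-balanced
    ... | K , p , p' with copies (r + 0)
                     (concatAt (λ i → blocks b c (r + suc i))) (concatAt (λ i → blocks c b (r + suc i)))
    ...   | P , P' , eq , q , q' = K + P , K + P' ,
      trans (+-assoc K P Jy) (trans (cong (K +_) eq) (sym (+-assoc K P' Jx))) ,
      found b c x p q , found c b y p' q'
      where
      found : ∀ l l' x {P} → σ K (F (concatAt (blocks l l'))) ≗ F (concatAt (λ i → blocks l l' (r + i))) →
        σ P (F (phase (r + 0) l l' ⌢ concatAt (λ i → blocks l l' (r + suc i)))) ≈[ r + 0 ] F x →
        σ (K + P) (F (concatAt (blocks l l'))) ≈[ r ] F x
      found l l' x {P} p q j j<r = begin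
        F (concatAt (blocks l l')) (K + P + j)
          ≡⟨ cong (F (concatAt (blocks l l'))) (+-assoc K P j) ⟩
        F (concatAt (blocks l l')) (K + (P + j))
          ≡⟨ p (P + j) ⟩
        F (concatAt (λ i → blocks l l' (r + i))) (P + j)
          ≡⟨ F-cong (concatAt-⌢ (λ i → blocks l l' (r + i))) (P + j) ⟩
        F (toList⁺ (blocks l l' (r + 0)) ⌢ z) (P + j)
          ≡⟨ cong (λ u → F (u ⌢ z) (P + j)) (toList-blocks l l' (r + 0)) ⟩
        F (phase (r + 0) l l' ⌢ z) (P + j)
          ≡⟨ q j (<-≤-trans j<r (m≤m+n r 0)) ⟩
        F x j ∎
        where
        open ≡-Reasoning
        z : Seq A
        z = concatAt (λ i → blocks l l' (r + suc i))

    unlevel⇒close : WLCompatible F → WL0 (F x) (F y)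
    unlevel⇒close compatible = LevWL0⇒WL0 (F x) (F y)
      (LevWL0-transfer (F x′) (F y′) (F x) (F y) Jy Jx
        (WL0⇒LevWL0 (F x′) (F y′) (compatible x′ y′ x′y′-close)) appears)

-- Bounds and searches over a finite alphabet

Fin-bounded : ∀ {n} (g : Fin n → ℕ) → ∃ λ M → ∀ i → g i ≤ M
Fin-bounded {zero} g = 0 , λ ()
Fin-bounded {suc n} g with Fin-bounded (λ i → g (suc i))
... | M , bound = g zero ⊔ M , λ where
  zero → m≤m⊔n (g zero) M
  (suc i) → ≤-trans (bound i) (m≤n⊔m (g zero) M)

-- Applied to block lengths, this supplies the bound `M` of the edit estimates.
Vec-bounded : ∀ {a} n (g : Vec (Fin a) n → ℕ) → ∃ λ M → ∀ v → g v ≤ M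
Vec-bounded zero g = g [] , λ { [] → ≤-refl }
Vec-bounded (suc n) g with Fin-bounded (λ i → proj₁ (Vec-bounded n (λ v → g (i ∷ v))))
... | M , bound = M , λ { (i ∷ v) → ≤-trans (proj₂ (Vec-bounded n (λ v → g (i ∷ v))) v) (bound i) }

Fin-search : ∀ {n} {P Q : Fin n → Set} → (∀ i → P i ⊎ Q i) → (∀ i → P i) ⊎ ∃ Q
Fin-search {zero} h = inj₁ λ ()
Fin-search {suc n} h with h zero | Fin-search (λ i → h (suc i))
... | inj₂ q | _ = inj₂ (zero , q)
... | inj₁ _ | inj₂ (i , q) = inj₂ (suc i , q)
... | inj₁ p | inj₁ ps = inj₁ λ { zero → p ; (suc i) → ps i }

word-search : ∀ {a} n {P Q : List (Fin a) → Set} → (∀ s → P s ⊎ Q s) →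
  (∀ s → length s ≡ n → P s) ⊎ ∃ λ s → length s ≡ n × Q s
word-search zero h with h []
... | inj₁ p = inj₁ λ { [] _ → p }
... | inj₂ q = inj₂ ([] , refl , q)
word-search (suc n) h with Fin-search (λ i → word-search n (λ s → h (i ∷ s)))
... | inj₁ p = inj₁ λ { (i ∷ s) eq → p i s (suc-injective eq) }
... | inj₂ (i , s , eq , q) = inj₂ (i ∷ s , cong suc eq , q)

module FiniteAlphabet (a θ : ℕ) (1≤θ : 1 ≤ θ) (f : Vec (Fin (suc a)) θ → List⁺ (Fin (suc a))) where

  open DillMap θ f
  open Padding zero θ 1≤θ f
  open Clean zero θ 1≤θ f

  -- The failure of `Level` must come with a witness, from which the sparse construction starts; a
  -- search through the finitely many `s` and `b` finds it.
  level? : Level ⊎ ∃ λ s → length s ≡ θ × ∃ λ b → W0 (s ++ [ b ]) ≢ W0 s + κ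
  level? = word-search θ (λ s → Fin-search (λ b → toSum (W0 (s ++ [ b ]) ≟ W0 s + κ)))

  diamond⇒compatible : DiamondUniform θ f → WLCompatible F
  diamond⇒compatible du with Vec-bounded θ (λ v → length (toList⁺ (f v)))
  ... | M , bound = Levelled.level⇒compatible (diamond⇒level du) M (λ x → bound (window θ x 0))

  unlevel⇒constant : ∀ s → length s ≡ θ → ∀ b → W0 (s ++ [ b ]) ≢ W0 s + κ →
    WLCompatible F → WLConstant F
  -- In `Unlevel` the letter `c` is the heavier one; the order of the weights tells whether `b` or
  -- `zero` takes that role.
  unlevel⇒constant s |s| b unequal compatible x y with <-cmp (W0 (s ++ [ b ])) (W0 (s ++ [ zero ]))
  ... | tri≈ _ eq _ = contradiction (trans eq (W0-snoc-o s)) unequal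
  ... | tri< lt _ _ = let (δ , eq) = m≤n⇒∃[o]m+o≡n lt in
    Unlevel.unlevel⇒close s |s| b zero δ (trans (sym eq) (sym (+-suc _ δ))) x y compatible
  ... | tri> _ _ gt = let (δ , eq) = m≤n⇒∃[o]m+o≡n gt in
    Unlevel.unlevel⇒close s |s| zero b δ (trans (sym eq) (sym (+-suc _ δ))) x y compatible

theorem3 : (a θ : ℕ) → 1 ≤ θ → (f : Vec (Fin a) θ → List⁺ (Fin a)) →
    WLCompatible (dill θ f) ⇔ (WLConstant (dill θ f) ⊎ DiamondUniform θ f)
-- Over the empty alphabet there are no sequences, as `x 0` would be a letter.
theorem3 zero θ 1≤θ f = mk⇔ (λ _ → inj₁ (λ x y → contradiction (x 0) λ ())) (λ _ x y → contradiction (x 0) λ ())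
theorem3 (suc a) θ 1≤θ f = mk⇔ to from
  where
  open FiniteAlphabet a θ 1≤θ f
  to : WLCompatible (dill θ f) → WLConstant (dill θ f) ⊎ DiamondUniform θ f
  to compatible with level?
  ... | inj₁ level = inj₂ (Padding.Levelled.level⇒diamond zero θ 1≤θ f level)
  ... | inj₂ (s , |s| , b , unequal) = inj₁ (unlevel⇒constant s |s| b unequal compatible)
  from : WLConstant (dill θ f) ⊎ DiamondUniform θ f → WLCompatible (dill θ f)
  from (inj₁ constant) x y _ = constant x y
  from (inj₂ du) = diamond⇒compatible du
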